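{- For every nondeterministic multihead finite automaton $\mathcal M$ with input alphabet $\Sigma$ there is an interpretation $\pi:\Gamma_2\to\Sigma$ such that for every sufficiently long string $x\in\Sigma^\star$, the structure $x^\pi$ is isomorphic to the configuration graph of $\mathcal M$ on input $x$ (as a 2-pointed directed graph). Furthermore, $\pi$ can be expanded to an interpretation $\pi:(\Gamma_2,S)\to\Sigma$ such that $x^\pi$ is a successor expansion of that configuration graph. Moreover, $\pi$ can be taken quantifier-free.
   Context: A nondeterministic multihead finite automaton (NMFA) consists of a finite set $Q$ of states, a number $k$ of heads, an input alphabet $\Sigma$, a start state $q_0$, an accept state $q_f$, and a transition relation $\delta$ which, depending on the current state and the $k$-tuple of symbols in $\Sigma\cup\{\triangleright,\triangleleft\}$ read by the heads, allows a new state and a move vector in $\{ -1,0,1\}^k$. The tape holds the input string between a left endmarker $\triangleright$ and a right endmarker $\triangleleft$; heads cannot write; a head reading $\triangleright$ (resp. $\triangleleft$) never moves left (resp. right); in state $q_f$ the transitions move every head left if possible and otherwise keep it in place. A configuration on input $x$ consists of the current state and the positions of the heads. The configuration graph on input $x$ is the 2-pointed directed graph whose vertices are the configurations on $x$, with an edge from $c$ to $c'$ iff $c'$ is reachable from $c$ in one step, and whose distinguished vertices $s,t$ are the initial configuration (state $q_0$, all heads at the left) and the final configuration (state $q_f$, all heads at the left). A string $x=x_0\cdots x_{n-1}\in\Sigma^\star$ is viewed as the structure with domain $\{0,\dots,n-1\}$, a unary predicate for each $\sigma\in\Sigma$ holding at $i$ iff $x_i=\sigma$, constants $\min=0$ and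 $\max=n-1$, and a successor function $S$ with $S(i)=i+1$; $\Sigma$ also denotes this signature. $\Gamma_2$ is the signature with a binary relation symbol $E$ and two constants $s,t$. A successor expansion of a finite structure $A$ is $(A,\min,\max,S)$ with $S$ the successor function of some linear order of the domain having endpoints $\min,\max$; $(\Gamma_2,S)$ is $\Gamma_2$ plus constants $\min,\max$ and the unary function symbol $S$. A $k$-ary interpretation $\pi:L\to K$ consists of a $K$-formula $\partial^\pi(\bar x)$ in a $k$-tuple of variables, for each $n$-ary relation symbol $r$ of $L$ a $K$-formula $r^\pi(\bar x_1,\dots,\bar x_n)$, and for each function or constant symbol of $L$ a definition by cases (cases given by $K$-formulas, values $k$-tuples of $K$-terms). It is quantifier-free if all these formulas are. For a $K$-structure $A$, $A^\pi$ is the $L$-structure with domain $\{\bar a\in A^k: A\models\partial^\pi(\bar a)\}$ and symbols interpreted by their translations. -}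

module Defs where

open import Data.Bool using (Bool; true)
open import Data.Empty using (⊥)
open import Data.Fin using (Fin; zero; suc; fromℕ; toℕ)
import Data.Fin as Fin
import Data.Fin.Properties as Finₚ
open import Data.Irrelevant using ([_])
open import Data.Nat using (ℕ; zero; suc; _*_; z≤n; s≤s)
import Data.Nat.Properties as ℕₚ
open import Data.Product using (Σ-syntax; ∃-syntax; _×_; _,_)
open import Data.Refinement using (Refinement; value; _,_)
open import Data.Sum using (_⊎_; inj₁; inj₂)
open import Data.Vec using (Vec; []; _∷_; concat; lookup; map; replicate; _∷ʳ_)
open import Function.Bundles using (_↔_; _⇔_; Inverse)
open import Function.Properties.Inverse using (↔⇒↣)
open import Level using (0ℓ)
open import Relation.Binary.Core using (Rel)
open import Relation.Binary.Definitions using (DecidableEquality)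
open import Relation.Binary.PropositionalEquality using (_≡_; _≢_; refl; sym; cong; subst)
open import Relation.Binary.Structures using (IsStrictTotalOrder)
open import Relation.Nullary using (¬_; Dec; yes; no; contradiction)
open import Relation.Nullary.Decidable using (map′; via-injection; _×-dec_; _⊎-dec_; _→-dec_)

-- Constants are function symbols of arity 0.
record Signature : Set₁ where
  field
    RelSym   : Set
    relArity : RelSym → ℕ
    FunSym   : Set
    funArity : FunSym → ℕ

open Signature public

record Structure (L : Signature) : Set₁ where
  field
    Carrier : Set
    rel     : (r : RelSym L) → Vec Carrier (relArity L r) → Set
    fun     : (f : FunSym L) → Vec Carrier (funArity L f) → Carrier

open Structure public

data Term (L : Signature) (n : ℕ) : Set where
  var : Fin n → Term L n
  app : (f : FunSym L) → Vec (Term L n) (funArity L f) → Term L n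

-- De Bruijn convention: a quantifier binds variable zero of its body.
data Formula (L : Signature) (n : ℕ) : Set where
  atom          : (r : RelSym L) → Vec (Term L n) (relArity L r) → Formula L n
  _≐_           : Term L n → Term L n → Formula L n
  falsum        : Formula L n
  _∧′_ _∨′_ _⇒′_ : Formula L n → Formula L n → Formula L n
  all′ ex′      : Formula L (suc n) → Formula L n

data QuantifierFree {L : Signature} {n : ℕ} : Formula L n → Set where
  atom   : ∀ r ts → QuantifierFree (atom r ts)
  _≐_    : ∀ t u → QuantifierFree (t ≐ u)
  falsum : QuantifierFree falsum
  _∧′_   : ∀ {φ ψ} → QuantifierFree φ → QuantifierFree ψ → QuantifierFree (φ ∧′ ψ)
  _∨′_   : ∀ {φ ψ} → QuantifierFree φ → QuantifierFree ψ → QuantifierFree (φ ∨′ ψ)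
  _⇒′_   : ∀ {φ ψ} → QuantifierFree φ → QuantifierFree ψ → QuantifierFree (φ ⇒′ ψ)

module Semantics {L : Signature} (A : Structure L) where

  mutual
    eval : ∀ {n} → Vec (Carrier A) n → Term L n → Carrier A
    eval ρ (var i)    = lookup ρ i
    eval ρ (app f ts) = fun A f (evals ρ ts)

    evals : ∀ {n m} → Vec (Carrier A) n → Vec (Term L n) m → Vec (Carrier A) m
    evals ρ []       = []
    evals ρ (t ∷ ts) = eval ρ t ∷ evals ρ ts

  Sat : ∀ {n} → Vec (Carrier A) n → Formula L n → Set
  Sat ρ (atom r ts) = rel A r (evals ρ ts)
  Sat ρ (t ≐ u)     = eval ρ t ≡ eval ρ u
  Sat ρ falsum      = ⊥
  Sat ρ (φ ∧′ ψ)    = Sat ρ φ × Sat ρ ψ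
  Sat ρ (φ ∨′ ψ)    = Sat ρ φ ⊎ Sat ρ ψ
  Sat ρ (φ ⇒′ ψ)    = Sat ρ φ → Sat ρ ψ
  Sat ρ (all′ φ)    = ∀ a → Sat (a ∷ ρ) φ
  Sat ρ (ex′ φ)     = ∃[ a ] Sat (a ∷ ρ) φ

open Semantics public

record IsFinite {L : Signature} (A : Structure L) : Set where
  field
    size        : ℕ
    enumeration : Carrier A ↔ Fin size
    rel?        : ∀ r as → Dec (rel A r as)

module FiniteSemantics {L : Signature} (A : Structure L) (fin : IsFinite A) where
  open IsFinite fin
  open Inverse enumeration using (to; from; strictlyInverseʳ)

  _≟_ : DecidableEquality (Carrier A)
  _≟_ = via-injection (↔⇒↣ enumeration) Finₚ._≟_

  sat? : ∀ {n} (ρ : Vec (Carrier A) n) (φ : Formula L n) → Dec (Sat A ρ φ)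
  sat? ρ (atom r ts) = rel? r (evals A ρ ts)
  sat? ρ (t ≐ u)     = eval A ρ t ≟ eval A ρ u
  sat? ρ falsum      = no λ ()
  sat? ρ (φ ∧′ ψ)    = sat? ρ φ ×-dec sat? ρ ψ
  sat? ρ (φ ∨′ ψ)    = sat? ρ φ ⊎-dec sat? ρ ψ
  sat? ρ (φ ⇒′ ψ)    = sat? ρ φ →-dec sat? ρ ψ
  sat? ρ (all′ φ)    = map′
    (λ h a → subst (λ b → Sat A (b ∷ ρ) φ) (strictlyInverseʳ a) (h (to a)))
    (λ h i → h (from i))
    (Finₚ.all? λ i → sat? (from i ∷ ρ) φ)
  sat? ρ (ex′ φ)     = map′
    (λ (i , h) → from i , h)
    (λ (a , h) → to a , subst (λ b → Sat A (b ∷ ρ) φ) (sym (strictlyInverseʳ a)) h)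
    (Finₚ.any? λ i → sat? (from i ∷ ρ) φ)

open FiniteSemantics public using (sat?)

infix 4 _≅_

record _≅_ {L : Signature} (A B : Structure L) : Set where
  field
    bijection : Carrier A ↔ Carrier B
  open Inverse bijection public using (to; from)
  field
    rel-iso : ∀ r as → rel A r as ⇔ rel B r (map to as)
    fun-iso : ∀ f as → to (fun A f as) ≡ fun B f (map to as)

-- The value is that of the first case whose condition holds.
data Cases (K : Signature) (n k : ℕ) : Set where
  otherwise    : Vec (Term K n) k → Cases K n k
  case_↦_else_ : Formula K n → Vec (Term K n) k → Cases K n k → Cases K n k

data QuantifierFreeCases {K : Signature} {n k : ℕ} : Cases K n k → Set where
  otherwise    : ∀ ts → QuantifierFreeCases (otherwise ts)
  case_↦_else_ : ∀ {φ cs} → QuantifierFree φ → ∀ ts → QuantifierFreeCases cs →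
                 QuantifierFreeCases (case φ ↦ ts else cs)

-- The variables of the formulas for an n-ary symbol are the n * k entries
-- of the concatenation of n k-tuples.
record Interpretation (L K : Signature) : Set where
  field
    arity : ℕ
    ∂     : Formula K arity
    relᴵ  : (r : RelSym L) → Formula K (relArity L r * arity)
    funᴵ  : (f : FunSym L) → Cases K (funArity L f * arity) arity

record QuantifierFreeInterpretation {L K : Signature} (π : Interpretation L K) : Set where
  open Interpretation π
  field
    ∂-qf   : QuantifierFree ∂
    rel-qf : ∀ r → QuantifierFree (relᴵ r)
    fun-qf : ∀ f → QuantifierFreeCases (funᴵ f)

-- Finiteness of A is what makes a definition by cases computable.
evalCases : ∀ {K} (A : Structure K) → IsFinite A →
            ∀ {n k} → Vec (Carrier A) n → Cases K n k → Vec (Carrier A) k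
evalCases A fin ρ (otherwise ts) = evals A ρ ts
evalCases A fin ρ (case φ ↦ ts else cs) with sat? A fin ρ φ
... | yes _ = evals A ρ ts
... | no  _ = evalCases A fin ρ cs

module _ {L K : Signature} (A : Structure K) (fin : IsFinite A) (π : Interpretation L K) where
  open Interpretation π

  -- Membership proofs are irrelevant, so that elements are equal as soon
  -- as the underlying tuples are.
  Domain : Set
  Domain = Refinement (Vec (Carrier A) arity) (λ a → Sat A a ∂)

  funValue : (f : FunSym L) → Vec Domain (funArity L f) → Vec (Carrier A) arity
  funValue f as = evalCases A fin (concat (map value as)) (funᴵ f)

  -- The condition under which A^π is an L-structure.
  Closed : Set
  Closed = ∀ f as → Sat A (funValue f as) ∂

  interpret : Closed → Structure L
  interpret closed = record
    { Carrier = Domain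
    ; rel     = λ r as → Sat A (concat (map value as)) (relᴵ r)
    ; fun     = λ f as → funValue f as , [ closed f as ]
    }

data SuccSym : Set where
  min max S : SuccSym

succArity : SuccSym → ℕ
succArity min = 0
succArity max = 0
succArity S   = 1

_+S : Signature → Signature
L +S = record
  { RelSym   = RelSym L
  ; relArity = relArity L
  ; FunSym   = FunSym L ⊎ SuccSym
  ; funArity = λ { (inj₁ f) → funArity L f ; (inj₂ c) → succArity c }
  }

-- As S is total, it needs a value at the greatest element, which is taken
-- to be a fixed point.
record Successor (X : Set) : Set₁ where
  field
    _<_                : Rel X 0ℓ
    isStrictTotalOrder : IsStrictTotalOrder _≡_ _<_
    least              : X
    greatest           : X
    next               : X → X
    least-min          : ∀ x → ¬ (x < least)
    greatest-max       : ∀ x → ¬ (greatest < x)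
    next-above         : ∀ x → x ≢ greatest → x < next x
    next-adjacent      : ∀ x y → x < y → ¬ (y < next x)
    next-greatest      : next greatest ≡ greatest

expand : ∀ {L} (A : Structure L) → Successor (Carrier A) → Structure (L +S)
expand A succ = record
  { Carrier = Carrier A
  ; rel     = rel A
  ; fun     = λ { (inj₁ f)   as       → fun A f as
                ; (inj₂ min) []       → least
                ; (inj₂ max) []       → greatest
                ; (inj₂ S)   (a ∷ []) → next a
                }
  }
  where open Successor succ

reduct : ∀ {L K} → Interpretation (L +S) K → Interpretation L K
reduct π = record
  { arity = arity
  ; ∂     = ∂
  ; relᴵ  = relᴵ
  ; funᴵ  = λ f → funᴵ (inj₁ f)
  }
  where open Interpretation π

nextFin : ∀ {n} → Fin (suc n) → Fin (suc n)
nextFin {zero}  i       = i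
nextFin {suc n} zero    = suc zero
nextFin {suc n} (suc i) = suc (nextFin i)

nextFin-above : ∀ {n} (i : Fin (suc n)) → i ≢ fromℕ n → i Fin.< nextFin i
nextFin-above {zero}  zero    i≢ = contradiction refl i≢
nextFin-above {suc n} zero    i≢ = s≤s z≤n
nextFin-above {suc n} (suc i) i≢ = s≤s (nextFin-above i λ eq → i≢ (cong suc eq))

nextFin-adjacent : ∀ {n} (i j : Fin (suc n)) → i Fin.< j → ¬ (j Fin.< nextFin i)
nextFin-adjacent {zero}  zero    zero    ()
nextFin-adjacent {suc n} zero    (suc j) _         (s≤s ())
nextFin-adjacent {suc n} (suc i) (suc j) (s≤s i<j) (s≤s j<) = nextFin-adjacent i j i<j j<

nextFin-greatest : ∀ n → nextFin (fromℕ n) ≡ fromℕ n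
nextFin-greatest zero    = refl
nextFin-greatest (suc n) = cong suc (nextFin-greatest n)

finSuccessor : ∀ n → Successor (Fin (suc n))
finSuccessor n = record
  { _<_                = Fin._<_
  ; isStrictTotalOrder = Finₚ.<-isStrictTotalOrder
  ; least              = zero
  ; greatest           = fromℕ n
  ; next               = nextFin
  ; least-min          = λ _ ()
  ; greatest-max       = λ i n<i → ℕₚ.<⇒≱ n<i (Finₚ.≤fromℕ i)
  ; next-above         = nextFin-above
  ; next-adjacent      = nextFin-adjacent
  ; next-greatest      = nextFin-greatest n
  }

-- One unary predicate for each letter of the alphabet Fin m.
Letters : ℕ → Signature
Letters m = record
  { RelSym = Fin m ; relArity = λ _ → 1 ; FunSym = ⊥ ; funArity = λ () }

StringSig : ℕ → Signature
StringSig m = Letters m +S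

letters : ∀ {m n} → Vec (Fin m) n → Structure (Letters m)
letters {n = n} x = record
  { Carrier = Fin n
  ; rel     = λ { σ (i ∷ []) → lookup x i ≡ σ }
  ; fun     = λ ()
  }

-- The empty string is excluded: it has no elements min and max.
⟦_⟧ : ∀ {m n} → Vec (Fin m) (suc n) → Structure (StringSig m)
⟦_⟧ {n = n} x = expand (letters x) (finSuccessor n)

⟦⟧-finite : ∀ {m n} (x : Vec (Fin m) (suc n)) → IsFinite ⟦ x ⟧
⟦⟧-finite {n = n} x = record
  { size        = suc n
  ; enumeration = ↔-id (Fin (suc n))
  ; rel?        = λ { σ (i ∷ []) → lookup x i Finₚ.≟ σ }
  }
  where open import Function.Construct.Identity using (↔-id)

data EdgeSym : Set where
  E : EdgeSym

data PointSym : Set where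
  s t : PointSym

Γ₂ : Signature
Γ₂ = record
  { RelSym = EdgeSym ; relArity = λ _ → 2 ; FunSym = PointSym ; funArity = λ _ → 0 }

data TapeSymbol (m : ℕ) : Set where
  ▷ ◁    : TapeSymbol m
  letter : Fin m → TapeSymbol m

data Move : Set where
  left stay right : Move

leftIfPossible : ∀ {m} → TapeSymbol m → Move
leftIfPossible ▷          = stay
leftIfPossible ◁          = left
leftIfPossible (letter _) = left

record NMFA (m : ℕ) : Set where
  field
    states  : ℕ
    heads   : ℕ
    q₀ qf   : Fin states
    δ       : Fin states → Vec (TapeSymbol m) heads → Fin states → Vec Move heads → Bool
    ▷-bound : ∀ q a q′ μ → δ q a q′ μ ≡ true →
              ∀ h → lookup a h ≡ ▷ → lookup μ h ≢ left
    ◁-bound : ∀ q a q′ μ → δ q a q′ μ ≡ true →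
              ∀ h → lookup a h ≡ ◁ → lookup μ h ≢ right
    -- The accept state is never left, and it has no other transitions.
    final   : ∀ a q′ μ → δ qf a q′ μ ≡ true ⇔ (q′ ≡ qf × μ ≡ map leftIfPossible a)

tape : ∀ {m n} → Vec (Fin m) n → Vec (TapeSymbol m) (suc (suc n))
tape x = ▷ ∷ (map letter x ∷ʳ ◁)

Displaces : ∀ {n} → Move → Fin n → Fin n → Set
Displaces left  p p′ = toℕ p ≡ suc (toℕ p′)
Displaces stay  p p′ = p ≡ p′
Displaces right p p′ = suc (toℕ p) ≡ toℕ p′

module _ {m : ℕ} (M : NMFA m) where
  open NMFA M

  -- Head positions on an input of length n: 0 is the left endmarker and
  -- n + 1 the right one.
  Configuration : ℕ → Set
  Configuration n = Fin states × Vec (Fin (suc (suc n))) heads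

  Step : ∀ {n} → Vec (Fin m) n → Configuration n → Configuration n → Set
  Step x (q , p) (q′ , p′) =
    Σ[ μ ∈ Vec Move heads ]
      δ q (map (lookup (tape x)) p) q′ μ ≡ true ×
      (∀ h → Displaces (lookup μ h) (lookup p h) (lookup p′ h))

  configurationGraph : ∀ {n} → Vec (Fin m) n → Structure Γ₂
  configurationGraph {n} x = record
    { Carrier = Configuration n
    ; rel     = λ { E (c ∷ c′ ∷ []) → Step x c c′ }
    ; fun     = λ { s [] → q₀ , replicate heads zero
                  ; t [] → qf , replicate heads zero
                  }
    }

{-# OPTIONS --safe #-}
module Submission where

-- A configuration is coded by a tuple of positions of x: the state q by the
-- numeral S^q(min), and each head by a pair of a tag and a position, the tag
-- telling the endmarkers from the letters. Tuples are ordered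
-- lexicographically; the successor increments the last component that is not
-- maximal and resets those after it, and maximality is an equation between
-- terms. An edge is a finite disjunction over the transitions of δ, as the
-- symbol under a head and the neighbours of its position are
-- quantifier-free definable.

open import Defs
open import Data.Bool using (Bool; true; false; if_then_else_)
open import Data.Fin using (Fin; zero; suc; fromℕ; inject₁; inject≤; toℕ)
import Data.Fin.Properties as Finₚ
open import Data.Fin.Relation.Unary.Top using (view; view-fromℕ; view-inject₁; ‵fromℕ; ‵inject₁)
open import Data.Irrelevant using ([_])
open import Data.Nat using (ℕ; zero; suc; pred; _+_; _≤_; s≤s)
import Data.Nat.Properties as ℕₚ
open import Data.Product using (Σ-syntax; ∃-syntax; _×_; _,_; proj₁; proj₂; uncurry)
open import Data.Product.Function.NonDependent.Propositional using (_×-⇔_)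
open import Data.Product.Relation.Binary.Lex.Strict using (×-Lex; ×-isStrictTotalOrder)
open import Data.Refinement using (value; _,_)
open import Data.Refinement.Properties using (value-injective)
open import Data.Sum using (_⊎_; inj₁; inj₂)
open import Data.Vec using (Vec; []; _∷_; _++_; _∷ʳ_; drop; lookup; map; replicate; tabulate; take; uncons)
open import Data.Vec.Properties using (lookup-map; tabulate∘lookup; take++drop≡id; tabulate-∘; ++-injectiveʳ; ++-injectiveˡ; ∷-injectiveˡ; ∷-injectiveʳ)
open import Function using (_∘_; _on_; flip)
open import Function.Bundles using (Equivalence; Inverse; _↔_; _⇔_; mk⇔; mk↔ₛ′)
open import Function.Properties.Equivalence using () renaming (trans to ⇔-trans)
open import Level using (0ℓ)
open import Relation.Binary.Construct.On using () renaming (isStrictTotalOrder to on-isStrictTotalOrder)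
open import Relation.Binary.Core using (Rel)
open import Relation.Binary.Definitions using (Trichotomous; tri<; tri≈; tri>)
open import Relation.Binary.PropositionalEquality using (_≡_; _≢_; refl; sym; trans; cong; cong₂; subst; isEquivalence)
open import Relation.Binary.Structures using (IsStrictTotalOrder)
open import Relation.Nullary using (¬_; Dec; yes; no; contradiction; recompute)

open Equivalence using () renaming (to to ⇒; from to ⇐)

-- Successor structures

-- The signature of strings offers `min`, `max` and `S` but no order, and quantifiers are not
-- allowed, so a coding may ask for no more than equality and successor. The order itself never
-- occurs in a formula: it lives on the set being coded, inside `Successor`. Hence the unit of the
-- proof is `Codes`: an injective coding of a set, a successor structure on that set, and the
-- correctness of the formulas and cases that define its image, endpoints and successor. Such
-- codings pass along bijections and to pairs, so configurations are assembled from states and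
-- single positions, and the passage to an interpretation is made once, for an arbitrary edge
-- formula. The length of the input matters only through the numerals, which must denote distinct
-- elements.

isStrictTotalOrder-≡ : {X : Set} {_≈_ _<_ : Rel X 0ℓ} → (∀ {x y} → x ≈ y → x ≡ y) →
                       IsStrictTotalOrder _≈_ _<_ → IsStrictTotalOrder _≡_ _<_
isStrictTotalOrder-≡ {X} {_≈_} {_<_} ≈⇒≡ sto = record
  { isStrictPartialOrder = record
    { isEquivalence = isEquivalence
    ; irrefl        = λ x≡y → irrefl (≡⇒≈ x≡y)
    ; trans         = <-trans
    ; <-resp-≈      = (λ { refl p → p }) , (λ { refl p → p })
    }
  ; compare = tri
  }
  where
  open IsStrictTotalOrder sto using (irrefl; compare; module Eq) renaming (trans to <-trans)

  ≡⇒≈ : ∀ {x y} → x ≡ y → x ≈ y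
  ≡⇒≈ refl = Eq.refl

  tri : Trichotomous _≡_ _<_
  tri x y with compare x y
  ... | tri< a b c = tri< a (b ∘ ≡⇒≈) c
  ... | tri≈ a b c = tri≈ a (≈⇒≡ b) c
  ... | tri> a b c = tri> a (b ∘ ≡⇒≈) c

module _ {X Y : Set} (f : X ↔ Y) (σ : Successor X) where
  open Inverse f using (to; from; strictlyInverseˡ; strictlyInverseʳ)
  open Successor σ

  from-injective : ∀ {x y} → from x ≡ from y → x ≡ y
  from-injective {x} {y} eq =
    trans (sym (strictlyInverseˡ x)) (trans (cong to eq) (strictlyInverseˡ y))

  transportSuccessor : Successor Y
  transportSuccessor = record
    { _<_                = _<_ on from
    ; isStrictTotalOrder =
        isStrictTotalOrder-≡ from-injective (on-isStrictTotalOrder from isStrictTotalOrder)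
    ; least              = to least
    ; greatest           = to greatest
    ; next               = λ y → to (next (from y))
    ; least-min          = λ y y<l →
        least-min _ (subst (from y <_) (strictlyInverseʳ _) y<l)
    ; greatest-max       = λ y g<y →
        greatest-max _ (subst (_< from y) (strictlyInverseʳ _) g<y)
    ; next-above         = λ y y≢g → subst (from y <_) (sym (strictlyInverseʳ _))
        (next-above _ λ eq → y≢g (trans (sym (strictlyInverseˡ y)) (cong to eq)))
    ; next-adjacent      = λ y z y<z z<n →
        next-adjacent _ _ y<z (subst (from z <_) (strictlyInverseʳ _) z<n)
    ; next-greatest      =
        cong to (trans (cong next (strictlyInverseʳ _)) next-greatest)
    }

module _ {X Y : Set} (σ : Successor X) (τ : Successor Y) where
  private
    module X = Successor σ
    module Y = Successor τ
    module X< = IsStrictTotalOrder X.isStrictTotalOrder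
    module Y< = IsStrictTotalOrder Y.isStrictTotalOrder

  -- The second component is the less significant digit. The cases depend only on equality with the
  -- greatest elements, so that they can be mirrored by equations between terms.
  lexNext : X × Y → X × Y
  lexNext (x , y) with y Y<.≟ Y.greatest | x X<.≟ X.greatest
  ... | yes _ | yes _ = x , y
  ... | yes _ | no  _ = X.next x , Y.least
  ... | no  _ | _     = x , Y.next y

  lexNext-greatest : lexNext (X.greatest , Y.greatest) ≡ (X.greatest , Y.greatest)
  lexNext-greatest with Y.greatest Y<.≟ Y.greatest | X.greatest X<.≟ X.greatest
  ... | yes _ | yes _ = refl
  ... | yes _ | no x≢ = contradiction refl x≢
  ... | no y≢ | _     = contradiction refl y≢

  private
    _<ₗₑₓ_ : Rel (X × Y) 0ℓ
    _<ₗₑₓ_ = ×-Lex _≡_ X._<_ Y._<_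

    above : ∀ p → p ≢ (X.greatest , Y.greatest) → p <ₗₑₓ lexNext p
    above (x , y) p≢ with y Y<.≟ Y.greatest | x X<.≟ X.greatest
    ... | yes y≡ | yes x≡ = contradiction (cong₂ _,_ x≡ y≡) p≢
    ... | yes _  | no x≢  = inj₁ (X.next-above x x≢)
    ... | no y≢  | _      = inj₂ (refl , Y.next-above y y≢)

    -- With a carry, `y` is greatest, so `p < q` forces `x < x′`; then `x′ < next x` contradicts
    -- adjacency in `X`, and `x′ ≡ next x` leaves `y′` below the least element. Without a carry,
    -- `x′` is caught between `x` and itself, and adjacency in `Y` decides.
    adjacent : ∀ p q → p <ₗₑₓ q → ¬ (q <ₗₑₓ lexNext p)
    adjacent (x , y) (x′ , y′) p<q q<n with y Y<.≟ Y.greatest | x X<.≟ X.greatest | p<q | q<n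
    ... | yes refl | yes refl | inj₁ x<           | _               = X.greatest-max _ x<
    ... | yes refl | yes _    | inj₂ (_ , y<)     | _               = Y.greatest-max _ y<
    ... | yes _    | no _     | inj₁ x<           | inj₁ x′<        = X.next-adjacent _ _ x< x′<
    ... | yes refl | no _     | inj₂ (_ , y<)     | _               = Y.greatest-max _ y<
    ... | yes _    | no _     | inj₁ _            | inj₂ (_ , y′<)  = Y.least-min _ y′<
    ... | no _     | _        | inj₁ x<           | inj₁ x′<        = X<.asym x< x′<
    ... | no _     | _        | inj₁ x<           | inj₂ (refl , _) = X<.irrefl refl x<
    ... | no _     | _        | inj₂ (refl , _)   | inj₁ x′<        = X<.irrefl refl x′<
    ... | no _     | _        | inj₂ (_ , y<)     | inj₂ (_ , y′<)  = Y.next-adjacent _ _ y< y′<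

  lexSuccessor : Successor (X × Y)
  lexSuccessor = record
    { _<_                = _<ₗₑₓ_
    -- The product order is total with respect to componentwise equality, which has to be turned
    -- into `_≡_`.
    ; isStrictTotalOrder = isStrictTotalOrder-≡ (λ (x≡ , y≡) → cong₂ _,_ x≡ y≡)
        (×-isStrictTotalOrder X.isStrictTotalOrder Y.isStrictTotalOrder)
    ; least              = X.least , Y.least
    ; greatest           = X.greatest , Y.greatest
    ; next               = lexNext
    ; least-min          = λ { _ (inj₁ x<) → X.least-min _ x< ; _ (inj₂ (_ , y<)) → Y.least-min _ y< }
    ; greatest-max       = λ { _ (inj₁ <x) → X.greatest-max _ <x ; _ (inj₂ (_ , <y)) → Y.greatest-max _ <y }
    ; next-above         = above
    ; next-adjacent      = adjacent
    ; next-greatest      = lexNext-greatest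
    }

-- Quantifier-free formulas and definitions by cases

module _ {K : Signature} {n : ℕ} where

  ⊤′ : Formula K n
  ⊤′ = falsum ⇒′ falsum

  infix 30 ¬′_
  ¬′_ : Formula K n → Formula K n
  ¬′ φ = φ ⇒′ falsum

  infix 30 _≐*_
  _≐*_ : ∀ {k} → Vec (Term K n) k → Vec (Term K n) k → Formula K n
  []       ≐* []       = ⊤′
  (a ∷ as) ≐* (b ∷ bs) = (a ≐ b) ∧′ (as ≐* bs)

  ≐*-qf : ∀ {k} (as bs : Vec (Term K n) k) → QuantifierFree (as ≐* bs)
  ≐*-qf []       []       = falsum ⇒′ falsum
  ≐*-qf (a ∷ as) (b ∷ bs) = (a ≐ b) ∧′ ≐*-qf as bs

  -- `Cases` is a flat list tried from the top, so a nested conditional has to be flattened: `φ` is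
  -- conjoined to every condition of `cs`, and the default of `cs` becomes a case with condition `φ`
  -- alone.
  ite : ∀ {k} → Formula K n → Cases K n k → Cases K n k → Cases K n k
  ite φ (otherwise ts)          ds = case φ ↦ ts else ds
  ite φ (case ψ ↦ ts else cs) ds = case φ ∧′ ψ ↦ ts else ite φ cs ds

  ite-qf : ∀ {k φ} {cs ds : Cases K n k} → QuantifierFree φ →
           QuantifierFreeCases cs → QuantifierFreeCases ds → QuantifierFreeCases (ite φ cs ds)
  ite-qf qφ (otherwise ts)           qds = case qφ ↦ ts else qds
  ite-qf qφ (case qψ ↦ ts else qcs) qds = case qφ ∧′ qψ ↦ ts else ite-qf qφ qcs qds

  mapCases : ∀ {k l} → (Vec (Term K n) k → Vec (Term K n) l) → Cases K n k → Cases K n l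
  mapCases f (otherwise ts)          = otherwise (f ts)
  mapCases f (case φ ↦ ts else cs) = case φ ↦ f ts else mapCases f cs

  mapCases-qf : ∀ {k l} (f : Vec (Term K n) k → Vec (Term K n) l) {cs} →
                QuantifierFreeCases cs → QuantifierFreeCases (mapCases f cs)
  mapCases-qf f (otherwise ts)           = otherwise (f ts)
  mapCases-qf f (case qφ ↦ ts else qcs) = case qφ ↦ f ts else mapCases-qf f qcs

  -- Allows a definition by cases to be used inside a formula, where only terms may occur. The
  -- negated condition expresses that the first case that holds is the one that counts.
  graph : ∀ {k} → Cases K n k → Vec (Term K n) k → Formula K n
  graph (otherwise ts)          us = ts ≐* us
  graph (case φ ↦ ts else cs) us = (φ ∧′ (ts ≐* us)) ∨′ (¬′ φ ∧′ graph cs us)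

  graph-qf : ∀ {k} {cs : Cases K n k} → QuantifierFreeCases cs → ∀ us → QuantifierFree (graph cs us)
  graph-qf (otherwise ts)           us = ≐*-qf ts us
  graph-qf (case qφ ↦ ts else qcs) us = (qφ ∧′ ≐*-qf ts us) ∨′ ((qφ ⇒′ falsum) ∧′ graph-qf qcs us)

-- Finite disjunctions

module _ {K : Signature} {n : ℕ} where

  -- Finiteness of an index set in the form needed here: disjunctions over it can be formed. Closure
  -- under vectors then reaches all tuples of symbols and all move vectors without numbering them.
  record Disjunction (I : Set) : Set₁ where
    field
      ⋁     : (I → Formula K n) → Formula K n
      ⋁-qf  : ∀ {φ} → (∀ i → QuantifierFree (φ i)) → QuantifierFree (⋁ φ)
      ⋁-sat : ∀ (A : Structure K) (ρ : Vec (Carrier A) n) φ →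
              Sat A ρ (⋁ φ) ⇔ (∃[ i ] Sat A ρ (φ i))

  open Disjunction

  finDisjunction : ∀ k → Disjunction (Fin k)
  finDisjunction zero = record
    { ⋁ = λ _ → falsum ; ⋁-qf = λ _ → falsum ; ⋁-sat = λ _ _ _ → mk⇔ (λ ()) (λ ()) }
  finDisjunction (suc k) = record
    { ⋁     = λ φ → φ zero ∨′ rest .⋁ (φ ∘ suc)
    ; ⋁-qf  = λ q → q zero ∨′ rest .⋁-qf (q ∘ suc)
    ; ⋁-sat = λ A ρ φ → mk⇔
        (λ { (inj₁ h) → zero , h
           ; (inj₂ h) → let i , h′ = ⇒ (rest .⋁-sat A ρ _) h in suc i , h′ })
        (λ { (zero , h) → inj₁ h ; (suc i , h) → inj₂ (⇐ (rest .⋁-sat A ρ _) (i , h)) })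
    }
    where rest = finDisjunction k

  symbolDisjunction : ∀ m → Disjunction (TapeSymbol m)
  symbolDisjunction m = record
    { ⋁     = λ φ → φ ▷ ∨′ (φ ◁ ∨′ rest .⋁ (φ ∘ letter))
    ; ⋁-qf  = λ q → q ▷ ∨′ (q ◁ ∨′ rest .⋁-qf (q ∘ letter))
    ; ⋁-sat = λ A ρ φ → mk⇔
        (λ { (inj₁ h)        → ▷ , h
           ; (inj₂ (inj₁ h)) → ◁ , h
           ; (inj₂ (inj₂ h)) → let i , h′ = ⇒ (rest .⋁-sat A ρ _) h in letter i , h′ })
        (λ { (▷ , h)        → inj₁ h
           ; (◁ , h)        → inj₂ (inj₁ h)
           ; (letter i , h) → inj₂ (inj₂ (⇐ (rest .⋁-sat A ρ _) (i , h))) })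
    }
    where rest = finDisjunction m

  moveDisjunction : Disjunction Move
  moveDisjunction = record
    { ⋁     = λ φ → φ left ∨′ (φ stay ∨′ φ right)
    ; ⋁-qf  = λ q → q left ∨′ (q stay ∨′ q right)
    ; ⋁-sat = λ A ρ φ → mk⇔
        (λ { (inj₁ h) → left , h ; (inj₂ (inj₁ h)) → stay , h ; (inj₂ (inj₂ h)) → right , h })
        (λ { (left , h) → inj₁ h ; (stay , h) → inj₂ (inj₁ h) ; (right , h) → inj₂ (inj₂ h) })
    }

  vecDisjunction : ∀ {I} → Disjunction I → ∀ k → Disjunction (Vec I k)
  vecDisjunction D zero = record
    { ⋁     = λ φ → φ []
    ; ⋁-qf  = λ q → q []
    ; ⋁-sat = λ _ _ _ → mk⇔ ([] ,_) (λ { ([] , h) → h })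
    }
  vecDisjunction D (suc k) = record
    { ⋁     = λ φ → D .⋁ λ i → rest .⋁ λ is → φ (i ∷ is)
    ; ⋁-qf  = λ q → D .⋁-qf λ i → rest .⋁-qf λ is → q (i ∷ is)
    ; ⋁-sat = λ A ρ φ → mk⇔
        (λ h → let i , h′ = ⇒ (D .⋁-sat A ρ _) h
                   is , h″ = ⇒ (rest .⋁-sat A ρ _) h′
               in i ∷ is , h″)
        (λ { (i ∷ is , h) → ⇐ (D .⋁-sat A ρ _) (i , ⇐ (rest .⋁-sat A ρ _) (is , h)) })
    }
    where rest = vecDisjunction D k

-- Semantics of tuples of terms, equations and cases

module _ {K : Signature} (A : Structure K) {n : ℕ} (ρ : Vec (Carrier A) n) where

  evals≡map : ∀ {k} (ts : Vec (Term K n) k) → evals A ρ ts ≡ map (eval A ρ) ts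
  evals≡map []       = refl
  evals≡map (t′ ∷ ts) = cong (eval A ρ t′ ∷_) (evals≡map ts)

  evals-++ : ∀ {k l} (ts : Vec (Term K n) k) (us : Vec (Term K n) l) →
             evals A ρ (ts ++ us) ≡ evals A ρ ts ++ evals A ρ us
  evals-++ []       us = refl
  evals-++ (t′ ∷ ts) us = cong (eval A ρ t′ ∷_) (evals-++ ts us)

  evals-split : ∀ k {l} (ts : Vec (Term K n) (k + l)) →
                evals A ρ (take k ts) ++ evals A ρ (drop k ts) ≡ evals A ρ ts
  evals-split k ts =
    trans (sym (evals-++ (take k ts) (drop k ts))) (cong (evals A ρ) (take++drop≡id k ts))

  evals-take : ∀ {k l} (ts : Vec (Term K n) (k + l)) {as bs} →
               evals A ρ ts ≡ as ++ bs → evals A ρ (take k ts) ≡ as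
  evals-take {k} ts eq = ++-injectiveˡ _ _ (trans (evals-split k ts) eq)

  evals-drop : ∀ {k l} (ts : Vec (Term K n) (k + l)) {as : Vec (Carrier A) k} {bs} →
               evals A ρ ts ≡ as ++ bs → evals A ρ (drop k ts) ≡ bs
  evals-drop {k} ts eq = ++-injectiveʳ (evals A ρ (take k ts)) _ (trans (evals-split k ts) eq)

  -- Links codes, which speak of arbitrary tuples of terms, to interpretations, whose formulas take
  -- the variables themselves.
  evals-vars : evals A ρ (tabulate var) ≡ ρ
  evals-vars = trans (evals≡map _) (trans (sym (tabulate-∘ (eval A ρ) var)) (tabulate∘lookup ρ))

  ≐*-sat : ∀ {k} (as bs : Vec (Term K n) k) →
           Sat A ρ (as ≐* bs) ⇔ (evals A ρ as ≡ evals A ρ bs)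
  ≐*-sat []       []       = mk⇔ (λ _ → refl) (λ _ h → h)
  ≐*-sat (a ∷ as) (b ∷ bs) = mk⇔
    (λ (h , hs) → cong₂ _∷_ h (⇒ (≐*-sat as bs) hs))
    (λ eq → ∷-injectiveˡ eq , ⇐ (≐*-sat as bs) (∷-injectiveʳ eq))

module _ {K : Signature} (A : Structure K) (fin : IsFinite A) {n : ℕ} (ρ : Vec (Carrier A) n) where

  evalCases-yes : ∀ {k} φ ts (cs : Cases K n k) → Sat A ρ φ →
                  evalCases A fin ρ (case φ ↦ ts else cs) ≡ evals A ρ ts
  evalCases-yes φ _ _ h with sat? A fin ρ φ
  ... | yes _ = refl
  ... | no ¬h = contradiction h ¬h

  evalCases-no : ∀ {k} φ ts (cs : Cases K n k) → ¬ Sat A ρ φ →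
                 evalCases A fin ρ (case φ ↦ ts else cs) ≡ evalCases A fin ρ cs
  evalCases-no φ _ _ ¬h with sat? A fin ρ φ
  ... | yes h = contradiction h ¬h
  ... | no _  = refl

  ite-yes : ∀ {k} φ (cs ds : Cases K n k) → Sat A ρ φ →
            evalCases A fin ρ (ite φ cs ds) ≡ evalCases A fin ρ cs
  ite-yes φ (otherwise ts) ds h = evalCases-yes φ ts ds h
  ite-yes φ (case ψ ↦ ts else cs) ds h = go (sat? A fin ρ ψ)
    where
    go : Dec (Sat A ρ ψ) → evalCases A fin ρ (ite φ (case ψ ↦ ts else cs) ds) ≡
                           evalCases A fin ρ (case ψ ↦ ts else cs)
    go (yes h′) = trans (evalCases-yes (φ ∧′ ψ) ts _ (h , h′)) (sym (evalCases-yes ψ ts cs h′))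
    go (no ¬h′) = trans (evalCases-no (φ ∧′ ψ) ts _ (¬h′ ∘ proj₂))
                    (trans (ite-yes φ cs ds h) (sym (evalCases-no ψ ts cs ¬h′)))

  ite-no : ∀ {k} φ (cs ds : Cases K n k) → ¬ Sat A ρ φ →
           evalCases A fin ρ (ite φ cs ds) ≡ evalCases A fin ρ ds
  ite-no φ (otherwise ts)          ds ¬h = evalCases-no φ ts ds ¬h
  ite-no φ (case ψ ↦ ts else cs) ds ¬h =
    trans (evalCases-no (φ ∧′ ψ) ts _ (¬h ∘ proj₁)) (ite-no φ cs ds ¬h)

  evalCases-map : ∀ {k l} (f : Vec (Term K n) k → Vec (Term K n) l)
                  (g : Vec (Carrier A) k → Vec (Carrier A) l) →
                  (∀ ts → evals A ρ (f ts) ≡ g (evals A ρ ts)) →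
                  ∀ cs → evalCases A fin ρ (mapCases f cs) ≡ g (evalCases A fin ρ cs)
  evalCases-map f g eq (otherwise ts) = eq ts
  evalCases-map f g eq (case φ ↦ ts else cs) with sat? A fin ρ φ
  ... | yes _ = eq ts
  ... | no  _ = evalCases-map f g eq cs

  graph-sat : ∀ {k} (cs : Cases K n k) us →
              Sat A ρ (graph cs us) ⇔ (evalCases A fin ρ cs ≡ evals A ρ us)
  graph-sat (otherwise ts) us = ≐*-sat A ρ ts us
  graph-sat (case φ ↦ ts else cs) us with sat? A fin ρ φ
  ... | yes h = mk⇔
    (λ { (inj₁ (_ , eq)) → ⇒ (≐*-sat A ρ ts us) eq ; (inj₂ (¬h , _)) → contradiction h ¬h })
    (λ eq → inj₁ (h , ⇐ (≐*-sat A ρ ts us) eq))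
  ... | no ¬h = mk⇔
    (λ { (inj₁ (h , _)) → contradiction h ¬h ; (inj₂ (_ , eq)) → ⇒ (graph-sat cs us) eq })
    (λ eq → inj₂ (¬h , ⇐ (graph-sat cs us) eq))

-- Coded sets

-- A code is given on tuples of terms rather than on variables, so that
-- codes compose without substitution into formulas.
record Code (K : Signature) : Set where
  field
    width     : ℕ
    domain    : ∀ {n} → Vec (Term K n) width → Formula K n
    lo hi     : ∀ {n} → Vec (Term K n) width
    step      : ∀ {n} → Vec (Term K n) width → Cases K n width
    domain-qf : ∀ {n} (ts : Vec (Term K n) width) → QuantifierFree (domain ts)
    step-qf   : ∀ {n} (ts : Vec (Term K n) width) → QuantifierFreeCases (step ts)

open Code

-- The semantic counterpart of a `Code` in one structure. By `domain-sat` the defined set is exactly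
-- the image of `code`, whereas `step-code` constrains `step` on codes only: its value on other
-- tuples is arbitrary.
record Codes {K : Signature} (A : Structure K) (fin : IsFinite A) (C : Code K) (X : Set) : Set₁ where
  field
    code           : X → Vec (Carrier A) (width C)
    code-injective : ∀ {x y} → code x ≡ code y → x ≡ y
    successor      : Successor X
  open Successor successor public
  field
    domain-sat : ∀ {n} (ρ : Vec (Carrier A) n) ts →
                 Sat A ρ (domain C ts) ⇔ (∃[ x ] evals A ρ ts ≡ code x)
    lo-code    : ∀ {n} (ρ : Vec (Carrier A) n) → evals A ρ (lo C) ≡ code least
    hi-code    : ∀ {n} (ρ : Vec (Carrier A) n) → evals A ρ (hi C) ≡ code greatest
    step-code  : ∀ {n} (ρ : Vec (Carrier A) n) ts {x} → evals A ρ ts ≡ code x →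
                 evalCases A fin ρ (step C ts) ≡ code (next x)

  ≐*-code : ∀ {n} (ρ : Vec (Carrier A) n) ts us {x y} → evals A ρ ts ≡ code x → evals A ρ us ≡ code y →
            Sat A ρ (ts ≐* us) ⇔ (x ≡ y)
  ≐*-code ρ ts us p q = ⇔-trans (≐*-sat A ρ ts us) (mk⇔
    (λ eq → code-injective (trans (sym p) (trans eq q)))
    (λ { refl → trans p (sym q) }))

module _ {K : Signature} where

  unitCode : Code K
  unitCode = record
    { width     = 0
    ; domain    = λ _ → ⊤′
    ; lo        = []
    ; hi        = []
    ; step      = otherwise
    ; domain-qf = λ _ → falsum ⇒′ falsum
    ; step-qf   = otherwise
    }

  -- The nested conditionals of `step` transcribe `lexNext`: the outer test decides whether to
  -- carry, the inner one whether the whole pair is already greatest.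
  pairCode : Code K → Code K → Code K
  pairCode C D = record
    { width     = k + width D
    ; domain    = λ ts → domain C (take k ts) ∧′ domain D (drop k ts)
    ; lo        = lo C ++ lo D
    ; hi        = hi C ++ hi D
    ; step      = λ ts →
        ite (drop k ts ≐* hi D)
          (ite (take k ts ≐* hi C)
            (otherwise ts)
            (mapCases (_++ lo D) (step C (take k ts))))
          (mapCases (take k ts ++_) (step D (drop k ts)))
    ; domain-qf = λ ts → domain-qf C (take k ts) ∧′ domain-qf D (drop k ts)
    ; step-qf   = λ ts →
        ite-qf (≐*-qf (drop k ts) (hi D))
          (ite-qf (≐*-qf (take k ts) (hi C))
            (otherwise ts)
            (mapCases-qf _ (step-qf C (take k ts))))
          (mapCases-qf _ (step-qf D (drop k ts)))
    }
    where k = width C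

  powerCode : Code K → ℕ → Code K
  powerCode C zero    = unitCode
  powerCode C (suc k) = pairCode C (powerCode C k)

module _ {K : Signature} {A : Structure K} {fin : IsFinite A} where

  transportCodes : ∀ {C X Y} → X ↔ Y → Codes A fin C X → Codes A fin C Y
  transportCodes {C} f 𝒳 = record
    { code           = λ y → code (from y)
    ; code-injective = λ eq → from-injective f successor (code-injective eq)
    ; successor      = transportSuccessor f successor
    ; domain-sat     = λ ρ ts → ⇔-trans (domain-sat ρ ts) (mk⇔
        (λ (x , eq) → to x , trans eq (cong code (sym (strictlyInverseʳ x))))
        (λ (y , eq) → from y , eq))
    ; lo-code        = λ ρ → trans (lo-code ρ) (cong code (sym (strictlyInverseʳ _)))
    ; hi-code        = λ ρ → trans (hi-code ρ) (cong code (sym (strictlyInverseʳ _)))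
    ; step-code      = λ ρ ts eq → trans (step-code ρ ts eq) (cong code (sym (strictlyInverseʳ _)))
    }
    where
    open Codes 𝒳
    open Inverse f using (to; from; strictlyInverseʳ)

  unitCodes : ∀ {X : Set} → Codes A fin unitCode (Vec X 0)
  unitCodes = record
    { code           = λ _ → []
    ; code-injective = λ { {[]} {[]} _ → refl }
    ; successor      = transportSuccessor Fin1↔ (finSuccessor 0)
    ; domain-sat     = λ { ρ [] → mk⇔ (λ _ → [] , refl) (λ _ h → h) }
    ; lo-code        = λ _ → refl
    ; hi-code        = λ _ → refl
    ; step-code      = λ { _ [] _ → refl }
    }
    where
    Fin1↔ : ∀ {X : Set} → Fin 1 ↔ Vec X 0
    Fin1↔ = mk↔ₛ′ (λ _ → []) (λ _ → zero) (λ { [] → refl }) (λ { zero → refl })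

  module _ {C D : Code K} {X Y : Set} (𝒳 : Codes A fin C X) (𝒴 : Codes A fin D Y) where
    private
      module X = Codes 𝒳
      module Y = Codes 𝒴

    pairCodes : Codes A fin (pairCode C D) (X × Y)
    pairCodes = record
      { code           = λ (x , y) → X.code x ++ Y.code y
      ; code-injective = λ {p} {q} eq → cong₂ _,_
          (X.code-injective (++-injectiveˡ _ _ eq))
          (Y.code-injective (++-injectiveʳ (X.code (proj₁ p)) (X.code (proj₁ q)) eq))
      ; successor      = lexSuccessor X.successor Y.successor
      ; domain-sat     = λ ρ ts →
          ⇔-trans (X.domain-sat ρ (take k ts) ×-⇔ Y.domain-sat ρ (drop k ts)) (mk⇔
            (λ ((x , p) , (y , q)) → (x , y) , trans (sym (evals-split A ρ k ts)) (cong₂ _++_ p q))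
            (λ ((x , y) , eq) → (x , evals-take A ρ ts eq) , (y , evals-drop A ρ ts eq)))
      ; lo-code        = λ ρ → trans (evals-++ A ρ (lo C) (lo D)) (cong₂ _++_ (X.lo-code ρ) (Y.lo-code ρ))
      ; hi-code        = λ ρ → trans (evals-++ A ρ (hi C) (hi D)) (cong₂ _++_ (X.hi-code ρ) (Y.hi-code ρ))
      ; step-code      = step-pair
      }
      where
      k = width C
      open Successor (lexSuccessor X.successor Y.successor) using (next)

      -- Since codes are injective, each syntactic comparison with `hi` holds exactly when that
      -- component is greatest (`≐*-code`). Hence the branch of `ite` that is taken is the branch of
      -- `lexNext`.
      step-pair : ∀ {n} (ρ : Vec (Carrier A) n) ts {p} →
                  evals A ρ ts ≡ X.code (proj₁ p) ++ Y.code (proj₂ p) →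
                  evalCases A fin ρ (step (pairCode C D) ts) ≡
                    X.code (proj₁ (next p)) ++ Y.code (proj₂ (next p))
      step-pair ρ ts {x , y} eq = result
        where
        eqˣ = evals-take A ρ ts eq
        eqʸ = evals-drop A ρ {k} ts {X.code x} eq
        atHiˣ = X.≐*-code ρ (take k ts) (hi C) eqˣ (X.hi-code ρ)
        atHiʸ = Y.≐*-code ρ (drop k ts) (hi D) eqʸ (Y.hi-code ρ)
        module X< = IsStrictTotalOrder X.isStrictTotalOrder
        module Y< = IsStrictTotalOrder Y.isStrictTotalOrder
        atTopˣ = take k ts ≐* hi C
        atTopʸ = drop k ts ≐* hi D
        carry = mapCases (_++ lo D) (step C (take k ts))
        inner = ite atTopˣ (otherwise ts) carry
        outer = mapCases (take k ts ++_) (step D (drop k ts))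

        result : evalCases A fin ρ (ite atTopʸ inner outer) ≡
                   X.code (proj₁ (next (x , y))) ++ Y.code (proj₂ (next (x , y)))
        result with y Y<.≟ Y.greatest | x X<.≟ X.greatest
        ... | yes y≡ | yes x≡ =
          trans (ite-yes A fin ρ atTopʸ inner outer (⇐ atHiʸ y≡))
            (trans (ite-yes A fin ρ atTopˣ (otherwise ts) carry (⇐ atHiˣ x≡)) eq)
        ... | yes y≡ | no x≢ =
          trans (ite-yes A fin ρ atTopʸ inner outer (⇐ atHiʸ y≡))
            (trans (ite-no A fin ρ atTopˣ (otherwise ts) carry (x≢ ∘ ⇒ atHiˣ))
              (trans (evalCases-map A fin ρ (_++ lo D) (_++ Y.code Y.least)
                        (λ us → trans (evals-++ A ρ us (lo D))
                                  (cong (evals A ρ us ++_) (Y.lo-code ρ)))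
                        (step C (take k ts)))
                (cong (_++ Y.code Y.least) (X.step-code ρ (take k ts) eqˣ))))
        ... | no y≢ | _ =
          trans (ite-no A fin ρ atTopʸ inner outer (y≢ ∘ ⇒ atHiʸ))
            (trans (evalCases-map A fin ρ (take k ts ++_) (X.code x ++_)
                      (λ us → trans (evals-++ A ρ (take k ts) us) (cong (_++ evals A ρ us) eqˣ))
                      (step D (drop k ts)))
              (cong (X.code x ++_) (Y.step-code ρ (drop k ts) eqʸ)))

  powerCodes : ∀ {C X} → Codes A fin C X → ∀ k → Codes A fin (powerCode C k) (Vec X k)
  powerCodes 𝒳 zero    = unitCodes
  powerCodes 𝒳 (suc k) = transportCodes cons↔ (pairCodes 𝒳 (powerCodes 𝒳 k))
    where
    cons↔ : ∀ {X : Set} {k} → (X × Vec X k) ↔ Vec X (suc k)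
    cons↔ = mk↔ₛ′ (uncurry _∷_) uncons (λ { (_ ∷ _) → refl }) (λ _ → refl)

-- Graphs on a coded set

module _ {K : Signature} (C : Code K)
         (edge : ∀ {n} → Vec (Term K n) (width C) → Vec (Term K n) (width C) → Formula K n)
         (edge-qf : ∀ {n} (ts us : Vec (Term K n) (width C)) → QuantifierFree (edge ts us))
         (point : PointSym → Vec (Term K 0) (width C)) where
  private w = width C

  graphInterpretation : Interpretation (Γ₂ +S) K
  graphInterpretation = record
    { arity = w
    ; ∂     = domain C (tabulate var)
    -- The variables form two blocks of length `w`; as `2 * w` unfolds to `w + (w + 0)`, the second
    -- block is again cut out by `take w`.
    ; relᴵ  = λ { E → edge (take w (tabulate var)) (take w (drop w (tabulate var))) }
    ; funᴵ  = λ { (inj₁ p)   → otherwise (point p)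
                ; (inj₂ min) → otherwise (lo C)
                ; (inj₂ max) → otherwise (hi C)
                ; (inj₂ S)   → step C (take w (tabulate var))
                }
    }

  graphInterpretation-qf : QuantifierFreeInterpretation graphInterpretation
  graphInterpretation-qf = record
    { ∂-qf   = domain-qf C _
    ; rel-qf = λ { E → edge-qf _ _ }
    ; fun-qf = λ { (inj₁ p)   → otherwise (point p)
                 ; (inj₂ min) → otherwise (lo C)
                 ; (inj₂ max) → otherwise (hi C)
                 ; (inj₂ S)   → step-qf C _
                 }
    }

  module _ {A : Structure K} {fin : IsFinite A} {G : Structure Γ₂} (𝒢 : Codes A fin C (Carrier G))
           (edge-sat : ∀ {n} (ρ : Vec (Carrier A) n) ts us {c d} →
                       evals A ρ ts ≡ Codes.code 𝒢 c → evals A ρ us ≡ Codes.code 𝒢 d →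
                       Sat A ρ (edge ts us) ⇔ rel G E (c ∷ d ∷ []))
           (point-code : ∀ p → evals A [] (point p) ≡ Codes.code 𝒢 (fun G p [])) where
    open Codes 𝒢
    private
      π = graphInterpretation
      D = Domain A fin π
      G⁺ = expand G successor

    domain⇔code : ∀ v → Sat A v (domain C (tabulate var)) ⇔ (∃[ c ] v ≡ code c)
    domain⇔code v = subst (λ u → Sat A v (domain C (tabulate var)) ⇔ (∃[ c ] u ≡ code c))
      (evals-vars A v) (domain-sat v (tabulate var))

    -- The membership proof carried by `d` is irrelevant, so no vertex can be read off from it
    -- directly. Satisfaction in a finite structure is decidable, which permits recomputing a
    -- relevant proof.
    decode : (d : D) → ∃[ c ] value d ≡ code c
    decode (v , [ h ]) = ⇒ (domain⇔code v) (recompute (sat? A fin v (domain C (tabulate var))) h)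

    toVertex : D → Carrier G
    toVertex d = proj₁ (decode d)

    fromVertex : Carrier G → D
    fromVertex c = code c , [ ⇐ (domain⇔code (code c)) (c , refl) ]

    -- The common source of closure of the domain under the translated symbols and of their
    -- preservation by `toVertex`.
    fun-code : ∀ f as → funValue A fin π f as ≡ code (fun G⁺ f (map toVertex as))
    fun-code (inj₁ p)   []       = point-code p
    fun-code (inj₂ min) []       = lo-code []
    fun-code (inj₂ max) []       = hi-code []
    fun-code (inj₂ S)   (d ∷ []) = step-code _ _
      (trans (evals-take A _ (tabulate var) (evals-vars A _)) (proj₂ (decode d)))

    graph-closed : Closed A fin π
    graph-closed f as = ⇐ (domain⇔code (funValue A fin π f as)) (_ , fun-code f as)

    graph-iso : interpret A fin π graph-closed ≅ G⁺
    graph-iso = record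
      { bijection = mk↔ₛ′ toVertex fromVertex
          (λ c → code-injective (sym (proj₂ (decode (fromVertex c)))))
          (λ d → value-injective (sym (proj₂ (decode d))))
      ; rel-iso   = λ { E (c ∷ d ∷ []) → edge-sat _ _ _
          (trans (evals-take A _ (tabulate var) (evals-vars A _)) (proj₂ (decode c)))
          (trans (evals-take A _ (drop w (tabulate var))
                    (evals-drop A _ (tabulate var) {value c} (evals-vars A _)))
                 (proj₂ (decode d))) }
      ; fun-iso   = λ f as → code-injective (trans
          (sym (proj₂ (decode (funValue A fin π f as , [ graph-closed f as ])))) (fun-code f as))
      }

-- Numerals in strings and the coding of states

module _ {m : ℕ} where

  num : ∀ {v} → ℕ → Term (StringSig m) v
  num zero    = app (inj₂ min) []
  num (suc i) = app (inj₂ S) (num i ∷ [])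

toℕ-nextFin : ∀ {n} (i : Fin (suc n)) → i ≢ fromℕ n → toℕ (nextFin i) ≡ suc (toℕ i)
toℕ-nextFin {zero}  zero    i≢ = contradiction refl i≢
toℕ-nextFin {suc n} zero    i≢ = refl
toℕ-nextFin {suc n} (suc i) i≢ = cong suc (toℕ-nextFin i (i≢ ∘ cong suc))

-- Used for right moves. The guard excludes the fixed point of `nextFin`, from which no displacement
-- to the right is possible.
nextFin⇔suc : ∀ {n} (i j : Fin (suc n)) →
              (i ≢ fromℕ n × nextFin i ≡ j) ⇔ (suc (toℕ i) ≡ toℕ j)
nextFin⇔suc {n} i j = mk⇔
  (λ { (i≢ , refl) → sym (toℕ-nextFin i i≢) })
  (λ eq → let i≢ = λ { refl → ℕₚ.<⇒≱ (ℕₚ.≤-reflexive eq) (Finₚ.≤fromℕ j) } in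
    i≢ , Finₚ.toℕ-injective (trans (toℕ-nextFin i i≢) eq))

-- Matches the successor of letters with that of head positions. The last letter is excepted because
-- the position after it is the right endmarker, as recorded in `nextFin-penultimate`.
nextFin-inject₁ : ∀ {n} (i : Fin (suc n)) → i ≢ fromℕ n → nextFin (inject₁ i) ≡ inject₁ (nextFin i)
nextFin-inject₁ {zero}  zero    i≢ = contradiction refl i≢
nextFin-inject₁ {suc n} zero    i≢ = refl
nextFin-inject₁ {suc n} (suc i) i≢ = cong suc (nextFin-inject₁ i (i≢ ∘ cong suc))

-- An initial segment is closed under successor except at its top, where `S` may leave it; this is
-- why the step of `finCode` tests for the last numeral.
nextFin-inject≤ : ∀ {r n} (q : Fin (suc r)) → q ≢ fromℕ r → (r≤n : suc r ≤ suc n) →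
                  nextFin (inject≤ q r≤n) ≡ inject≤ (nextFin q) r≤n
nextFin-inject≤ {zero}          zero    q≢ _         = contradiction refl q≢
nextFin-inject≤ {suc r} {suc n} zero    _  (s≤s _)   = refl
nextFin-inject≤ {suc r} {suc n} (suc q) q≢ (s≤s r≤n) =
  cong suc (nextFin-inject≤ q (q≢ ∘ cong suc) r≤n)

nextFin-penultimate : ∀ n → nextFin (inject₁ (fromℕ n)) ≡ fromℕ (suc n)
nextFin-penultimate zero    = refl
nextFin-penultimate (suc n) = cong suc (nextFin-penultimate n)

module _ {m n v : ℕ} (x : Vec (Fin m) (suc n)) (ρ : Vec (Fin (suc n)) v) where

  -- The bound ensures that each `S` in the numeral is applied strictly below `max`, so the fixed
  -- point never interferes.
  toℕ-num : ∀ i → i ≤ n → toℕ (eval ⟦ x ⟧ ρ (num i)) ≡ i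
  toℕ-num zero    _   = refl
  toℕ-num (suc i) i<n = trans
    (toℕ-nextFin _ λ eq → ℕₚ.<⇒≢ i<n
      (trans (sym (toℕ-num i (ℕₚ.<⇒≤ i<n))) (trans (cong toℕ eq) (Finₚ.toℕ-fromℕ n))))
    (cong suc (toℕ-num i (ℕₚ.<⇒≤ i<n)))

  num-inject≤ : ∀ {Q} (q : Fin Q) (Q≤ : Q ≤ suc n) → eval ⟦ x ⟧ ρ (num (toℕ q)) ≡ inject≤ q Q≤
  num-inject≤ q Q≤ = Finₚ.toℕ-injective (trans
    (toℕ-num (toℕ q) (ℕₚ.≤-pred (ℕₚ.≤-trans (Finₚ.toℕ<n q) Q≤)))
    (sym (Finₚ.toℕ-inject≤ q Q≤)))

module _ {m : ℕ} where

  numeral : ∀ {v Q} → Fin Q → Vec (Term (StringSig m) v) 1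
  numeral q = num (toℕ q) ∷ []

  finCode : ℕ → Code (StringSig m)
  finCode Q = record
    { width     = 1
    ; domain    = λ ts → ⋁ λ q → ts ≐* numeral q
    ; lo        = num 0 ∷ []
    -- The numeral of the last element; at `Q = 0` it is a dummy value.
    ; hi        = num (pred Q) ∷ []
    ; step      = λ ts → case ts ≐* (num (pred Q) ∷ []) ↦ ts
                         else otherwise (map (λ a → app (inj₂ S) (a ∷ [])) ts)
    ; domain-qf = λ ts → ⋁-qf λ q → ≐*-qf ts (numeral q)
    ; step-qf   = λ ts → case ≐*-qf ts _ ↦ ts else otherwise _
    }
    where open module ⋁ {v} = Disjunction (finDisjunction {n = v} Q) using (⋁; ⋁-qf)

  module _ {n : ℕ} (x : Vec (Fin m) (suc n)) where

    numeral-code : ∀ {v} (ρ : Vec (Fin (suc n)) v) {Q} (Q≤ : Q ≤ suc n) (q : Fin Q) →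
                   evals ⟦ x ⟧ ρ (numeral q) ≡ inject≤ q Q≤ ∷ []
    numeral-code ρ Q≤ q = cong (_∷ []) (num-inject≤ x ρ q Q≤)

    -- A successor structure has endpoints, so the set must be inhabited; for an automaton the start
    -- state serves as the inhabitant.
    finCodes : ∀ {Q} → Fin Q → Q ≤ suc n → Codes ⟦ x ⟧ (⟦⟧-finite x) (finCode Q) (Fin Q)
    finCodes {suc r} _ Q≤ = record
      { code           = code
      ; code-injective = λ eq → Finₚ.inject≤-injective Q≤ Q≤ _ _ (∷-injectiveˡ eq)
      ; successor      = finSuccessor r
      ; domain-sat     = λ ρ ts → ⇔-trans
          (Disjunction.⋁-sat (finDisjunction (suc r)) ⟦ x ⟧ ρ (λ q → ts ≐* numeral q)) (mk⇔
            (λ (q , h) → q , trans (⇒ (≐*-sat ⟦ x ⟧ ρ ts (numeral q)) h) (numeral-code ρ Q≤ q))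
            (λ (q , eq) → q , ⇐ (≐*-sat ⟦ x ⟧ ρ ts (numeral q)) (trans eq (sym (numeral-code ρ Q≤ q)))))
      ; lo-code        = λ ρ → numeral-code ρ Q≤ zero
      ; hi-code        = hi-code
      ; step-code      = step-fin
      }
      where
      code : Fin (suc r) → Vec (Fin (suc n)) 1
      code q = inject≤ q Q≤ ∷ []

      hi-code : ∀ {v} (ρ : Vec (Fin (suc n)) v) → evals ⟦ x ⟧ ρ (num r ∷ []) ≡ code (fromℕ r)
      hi-code ρ = trans (cong (λ i → eval ⟦ x ⟧ ρ (num i) ∷ []) (sym (Finₚ.toℕ-fromℕ r)))
                        (numeral-code ρ Q≤ (fromℕ r))

      step-fin : ∀ {v} (ρ : Vec (Fin (suc n)) v) ts {q} → evals ⟦ x ⟧ ρ ts ≡ code q →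
                 evalCases ⟦ x ⟧ (⟦⟧-finite x) ρ (step (finCode (suc r)) ts) ≡ code (nextFin q)
      step-fin ρ (a ∷ []) {q} eq = go (q Finₚ.≟ fromℕ r)
        where
        top = (a ∷ []) ≐* (num r ∷ [])
        Sa = app (inj₂ S) (a ∷ []) ∷ []

        go : Dec (q ≡ fromℕ r) →
             evalCases ⟦ x ⟧ (⟦⟧-finite x) ρ (step (finCode (suc r)) (a ∷ [])) ≡ code (nextFin q)
        go (yes refl) = trans
          (evalCases-yes ⟦ x ⟧ (⟦⟧-finite x) ρ top (a ∷ []) (otherwise Sa)
            (⇐ (≐*-sat ⟦ x ⟧ ρ (a ∷ []) (num r ∷ [])) (trans eq (sym (hi-code ρ)))))
          (trans eq (cong code (sym (nextFin-greatest r))))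
        go (no q≢) = trans
          (evalCases-no ⟦ x ⟧ (⟦⟧-finite x) ρ top (a ∷ []) (otherwise Sa)
            λ h → q≢ (Finₚ.inject≤-injective Q≤ Q≤ _ _ (∷-injectiveˡ
              (trans (sym eq) (trans (⇒ (≐*-sat ⟦ x ⟧ ρ (a ∷ []) (num r ∷ [])) h) (hi-code ρ))))))
          (cong (_∷ []) (trans (cong nextFin (∷-injectiveˡ eq)) (nextFin-inject≤ q q≢ Q≤)))

    numeral-finCode : ∀ {v} (ρ : Vec (Fin (suc n)) v) {Q} (q₀ : Fin Q) (Q≤ : Q ≤ suc n) (q : Fin Q) →
                      evals ⟦ x ⟧ ρ (numeral q) ≡ Codes.code (finCodes q₀ Q≤) q
    numeral-finCode ρ {suc r} _ Q≤ q = numeral-code ρ Q≤ q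

-- Head positions

data PositionView {n : ℕ} : Fin (suc (suc n)) → Set where
  atLeft  : PositionView zero
  inside  : (i : Fin n) → PositionView (suc (inject₁ i))
  atRight : PositionView (suc (fromℕ n))

positionView : ∀ {n} (p : Fin (suc (suc n))) → PositionView p
positionView zero = atLeft
positionView (suc p) with view p
... | ‵fromℕ     = atRight
... | ‵inject₁ i = inside i

positionView-inside : ∀ {n} (i : Fin n) → positionView (suc (inject₁ i)) ≡ inside i
positionView-inside i rewrite view-inject₁ i = refl

positionView-atRight : ∀ n → positionView (suc (fromℕ n)) ≡ atRight
positionView-atRight n rewrite view-fromℕ n = refl

lookup-∷ʳ-inject₁ : ∀ {X : Set} {n} (xs : Vec X n) y i → lookup (xs ∷ʳ y) (inject₁ i) ≡ lookup xs i
lookup-∷ʳ-inject₁ (_ ∷ _)  y zero    = refl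
lookup-∷ʳ-inject₁ (_ ∷ xs) y (suc i) = lookup-∷ʳ-inject₁ xs y i

lookup-∷ʳ-fromℕ : ∀ {X : Set} {n} (xs : Vec X n) y → lookup (xs ∷ʳ y) (fromℕ n) ≡ y
lookup-∷ʳ-fromℕ []       y = refl
lookup-∷ʳ-fromℕ (_ ∷ xs) y = lookup-∷ʳ-fromℕ xs y

module _ {m : ℕ} where

  -- A position is coded by a tag and an element: (0 , 0) is the left
  -- endmarker, (1 , i) the i-th letter and (2 , 0) the right endmarker.
  positionCode : Code (StringSig m)
  positionCode = record
    { width     = 2
    ; domain    = λ { (a ∷ b ∷ []) →
        ((a ≐ num 0) ∧′ (b ≐ num 0)) ∨′ ((a ≐ num 1) ∨′ ((a ≐ num 2) ∧′ (b ≐ num 0))) }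
    ; lo        = num 0 ∷ num 0 ∷ []
    ; hi        = num 2 ∷ num 0 ∷ []
    ; step      = λ { (a ∷ b ∷ []) →
        case a ≐ num 0                ↦ num 1 ∷ num 0 ∷ [] else
        case a ≐ num 2                ↦ a ∷ b ∷ []         else
        case b ≐ app (inj₂ max) []    ↦ num 2 ∷ num 0 ∷ [] else
        otherwise (num 1 ∷ app (inj₂ S) (b ∷ []) ∷ []) }
    ; domain-qf = λ { (a ∷ b ∷ []) →
        ((a ≐ num 0) ∧′ (b ≐ num 0)) ∨′ ((a ≐ num 1) ∨′ ((a ≐ num 2) ∧′ (b ≐ num 0))) }
    ; step-qf   = λ { (a ∷ b ∷ []) →
        case a ≐ num 0 ↦ _ else case a ≐ num 2 ↦ _ else
        case b ≐ app (inj₂ max) [] ↦ _ else otherwise _ }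
    }

  -- Among codes of positions the tag alone identifies an endmarker, so the second component is
  -- inspected for letters only.
  reads : ∀ {v} → TapeSymbol m → Vec (Term (StringSig m) v) 2 → Formula (StringSig m) v
  reads ▷          (a ∷ b ∷ []) = a ≐ num 0
  reads ◁          (a ∷ b ∷ []) = a ≐ num 2
  reads (letter σ) (a ∷ b ∷ []) = (a ≐ num 1) ∧′ atom σ (b ∷ [])

  reads-qf : ∀ {v} c (ts : Vec (Term (StringSig m) v) 2) → QuantifierFree (reads c ts)
  reads-qf ▷          (a ∷ b ∷ []) = a ≐ num 0
  reads-qf ◁          (a ∷ b ∷ []) = a ≐ num 2
  reads-qf (letter σ) (a ∷ b ∷ []) = (a ≐ num 1) ∧′ atom σ (b ∷ [])

  -- No term denotes a predecessor, so a left move is a right move read backwards. A right move must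
  -- exclude the greatest position explicitly because `step` fixes it.
  moves : ∀ {v} → Move → (ts us : Vec (Term (StringSig m) v) 2) → Formula (StringSig m) v
  moves left  ts us = moves right us ts
  moves stay  ts us = ts ≐* us
  moves right ts us = ¬′ (ts ≐* hi positionCode) ∧′ graph (step positionCode ts) us

  moves-qf : ∀ {v} μ (ts us : Vec (Term (StringSig m) v) 2) → QuantifierFree (moves μ ts us)
  moves-qf left  ts us = moves-qf right us ts
  moves-qf stay  ts us = ≐*-qf ts us
  moves-qf right ts us =
    (≐*-qf ts (hi positionCode) ⇒′ falsum) ∧′ graph-qf (step-qf positionCode ts) us

  module _ {n : ℕ} (x : Vec (Fin m) (suc (suc (suc n)))) where
    private
      N : ℕ
      N = suc (suc (suc n))
      A = ⟦ x ⟧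
      fin = ⟦⟧-finite x

    tagged : {p : Fin (suc (suc N))} → PositionView p → Vec (Fin N) 2
    tagged atLeft     = zero ∷ zero ∷ []
    tagged (inside i) = suc zero ∷ i ∷ []
    tagged atRight    = suc (suc zero) ∷ zero ∷ []

    tagged-injective : ∀ {p q} (P : PositionView p) (Q : PositionView q) → tagged P ≡ tagged Q → p ≡ q
    tagged-injective atLeft     atLeft     _    = refl
    tagged-injective (inside i) (inside j) refl = refl
    tagged-injective atRight    atRight    _    = refl

    positionCodes : Codes A fin positionCode (Fin (suc (suc N)))
    positionCodes = record
      { code           = code
      ; code-injective = λ {p} {q} → tagged-injective (positionView p) (positionView q)
      ; successor      = finSuccessor (suc N)
      ; domain-sat     = λ { ρ (a ∷ b ∷ []) → mk⇔
          (λ { (inj₁ (p , q))        → zero , cong₂ pair p q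
             -- Every element of the string is the position of a letter, so tag 1 puts no condition
             -- on `b`, and its value is the index of that letter.
             ; (inj₂ (inj₁ p))        → suc (inject₁ (eval A ρ b)) ,
                 trans (cong (λ c → pair c (eval A ρ b)) p)
                       (sym (cong tagged (positionView-inside (eval A ρ b))))
             ; (inj₂ (inj₂ (p , q))) → suc (fromℕ N) ,
                 trans (cong₂ pair p q) (sym (cong tagged (positionView-atRight N))) })
          (λ (p , eq) → untag (positionView p) (cong (flip lookup zero) eq) (cong (flip lookup (suc zero)) eq)) }
      ; lo-code        = λ _ → refl
      ; hi-code        = λ _ → sym (cong tagged (positionView-atRight N))
      ; step-code      = λ ρ ts {p} → step-position ρ ts (positionView p)
      }
      where
      pair : Fin N → Fin N → Vec (Fin N) 2
      pair i j = i ∷ j ∷ []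

      code : Fin (suc (suc N)) → Vec (Fin N) 2
      code p = tagged (positionView p)

      untag : ∀ {i j p} (P : PositionView p) → i ≡ lookup (tagged P) zero → j ≡ lookup (tagged P) (suc zero) →
              (i ≡ zero × j ≡ zero) ⊎ (i ≡ suc zero ⊎ (i ≡ suc (suc zero) × j ≡ zero))
      untag atLeft     p q = inj₁ (p , q)
      untag (inside _) p q = inj₂ (inj₁ p)
      untag atRight    p q = inj₂ (inj₂ (p , q))

      -- The case with content is that of a letter. Below the last letter, `S` on the string gives
      -- the next position with the same tag; at the last one `S` would stay in place, so the tag
      -- has to change to that of the right endmarker.
      step-position : ∀ {v} (ρ : Vec (Fin N) v) ts {p} (P : PositionView p) →
                      evals A ρ ts ≡ tagged P →
                      evalCases A fin ρ (step positionCode ts) ≡ code (nextFin p)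
      step-position ρ (a ∷ b ∷ []) P eq = go P (cong (flip lookup zero) eq) (cong (flip lookup (suc zero)) eq)
        where
        b≐max = b ≐ app (inj₂ max) []
        inc = otherwise (num 1 ∷ app (inj₂ S) (b ∷ []) ∷ [])
        last = case b≐max ↦ num 2 ∷ num 0 ∷ [] else inc
        tail = case a ≐ num 2 ↦ a ∷ b ∷ [] else last

        left-yes : eval A ρ a ≡ zero → evalCases A fin ρ (step positionCode (a ∷ b ∷ [])) ≡ pair (suc zero) zero
        left-yes = evalCases-yes A fin ρ (a ≐ num 0) (num 1 ∷ num 0 ∷ []) tail

        left-no : eval A ρ a ≢ zero →
                  evalCases A fin ρ (step positionCode (a ∷ b ∷ [])) ≡ evalCases A fin ρ tail
        left-no = evalCases-no A fin ρ (a ≐ num 0) (num 1 ∷ num 0 ∷ []) tail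

        inside-step : ∀ i → eval A ρ b ≡ i → Dec (i ≡ fromℕ (suc (suc n))) →
                      evalCases A fin ρ last ≡ code (suc (nextFin (inject₁ i)))
        inside-step i q (yes refl) = trans
          (evalCases-yes A fin ρ b≐max (num 2 ∷ num 0 ∷ []) inc q)
          (sym (trans (cong (code ∘ suc) (nextFin-penultimate _)) (cong tagged (positionView-atRight N))))
        inside-step i q (no i≢) = trans
          (evalCases-no A fin ρ b≐max (num 2 ∷ num 0 ∷ []) inc (i≢ ∘ trans (sym q)))
          (trans (cong (pair (suc zero) ∘ nextFin) q)
            (sym (trans (cong (code ∘ suc) (nextFin-inject₁ i i≢))
                        (cong tagged (positionView-inside (nextFin i))))))

        go : ∀ {p} (P : PositionView p) → eval A ρ a ≡ lookup (tagged P) zero →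
             eval A ρ b ≡ lookup (tagged P) (suc zero) →
             evalCases A fin ρ (step positionCode (a ∷ b ∷ [])) ≡ code (nextFin p)
        go atLeft     p q = left-yes p
        go (inside i) p q =
          trans (left-no λ p′ → 0≢1 (trans (sym p′) p))
            (trans (evalCases-no A fin ρ (a ≐ num 2) (a ∷ b ∷ []) last λ p′ → 2≢1 (trans (sym p′) p))
              (inside-step i q (i Finₚ.≟ _)))
          where
          0≢1 : zero ≢ Fin.suc {suc (suc n)} zero
          0≢1 ()
          2≢1 : suc (suc zero) ≢ Fin.suc {suc (suc n)} zero
          2≢1 ()
        go atRight    p q =
          trans (left-no λ p′ → 0≢2 (trans (sym p′) p))
            (trans (evalCases-yes A fin ρ (a ≐ num 2) (a ∷ b ∷ []) last p)
              (trans (cong₂ pair p q)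
                (sym (trans (cong (code ∘ suc) (nextFin-greatest _))
                            (cong tagged (positionView-atRight N))))))
          where
          0≢2 : zero ≢ Fin.suc {suc (suc n)} (suc zero)
          0≢2 ()

    module 𝒫 = Codes positionCodes

    reads-sat : ∀ {v} (ρ : Vec (Fin N) v) c ts {p} → evals A ρ ts ≡ 𝒫.code p →
                Sat A ρ (reads c ts) ⇔ (lookup (tape x) p ≡ c)
    reads-sat ρ c (a ∷ b ∷ []) {p} eq = go c (positionView p) (cong (flip lookup zero) eq) (cong (flip lookup (suc zero)) eq)
      where
      go : ∀ c {p} (P : PositionView p) → eval A ρ a ≡ lookup (tagged P) zero →
           eval A ρ b ≡ lookup (tagged P) (suc zero) →
           Sat A ρ (reads c (a ∷ b ∷ [])) ⇔ (lookup (tape x) p ≡ c)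
      go ▷          atLeft     p q rewrite p | q = mk⇔ (λ _ → refl) (λ _ → refl)
      go ◁          atLeft     p q rewrite p | q = mk⇔ (λ ()) (λ ())
      go (letter σ) atLeft     p q rewrite p | q = mk⇔ (λ ()) (λ ())
      go ▷          (inside i) p q rewrite p | q | lookup-∷ʳ-inject₁ (map letter x) ◁ i | lookup-map i letter x = mk⇔ (λ ()) (λ ())
      go ◁          (inside i) p q rewrite p | q | lookup-∷ʳ-inject₁ (map letter x) ◁ i | lookup-map i letter x = mk⇔ (λ ()) (λ ())
      go (letter σ) (inside i) p q rewrite p | q | lookup-∷ʳ-inject₁ (map letter x) ◁ i | lookup-map i letter x =
        mk⇔ (λ (_ , h) → cong letter h) (λ { refl → refl , refl })
      go ▷          atRight    p q rewrite p | q | lookup-∷ʳ-fromℕ (map letter x) ◁ = mk⇔ (λ ()) (λ ())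
      go ◁          atRight    p q rewrite p | q | lookup-∷ʳ-fromℕ (map letter x) ◁ = mk⇔ (λ _ → refl) (λ _ → refl)
      go (letter σ) atRight    p q rewrite p | q | lookup-∷ʳ-fromℕ (map letter x) ◁ = mk⇔ (λ ()) (λ ())

    moves-sat : ∀ {v} (ρ : Vec (Fin N) v) μ ts us {p q} → evals A ρ ts ≡ 𝒫.code p → evals A ρ us ≡ 𝒫.code q →
                Sat A ρ (moves μ ts us) ⇔ Displaces μ p q
    -- `Displaces left p q` and `Displaces right q p` are one equation with its sides exchanged.
    moves-sat ρ left  ts us eqᵖ eqᑫ = ⇔-trans (moves-sat ρ right us ts eqᑫ eqᵖ) (mk⇔ sym sym)
    moves-sat ρ stay  ts us eqᵖ eqᑫ = 𝒫.≐*-code ρ ts us eqᵖ eqᑫ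
    moves-sat ρ right ts us {p} {q} eqᵖ eqᑫ = ⇔-trans (top ×-⇔ next) (nextFin⇔suc p q)
      where
      hiᵖ = 𝒫.≐*-code ρ ts (hi positionCode) eqᵖ (𝒫.hi-code ρ)

      top : (¬ Sat A ρ (ts ≐* hi positionCode)) ⇔ (p ≢ fromℕ (suc N))
      top = mk⇔ (_∘ ⇐ hiᵖ) (_∘ ⇒ hiᵖ)

      next : Sat A ρ (graph (step positionCode ts) us) ⇔ (nextFin p ≡ q)
      next = ⇔-trans (graph-sat A fin ρ (step positionCode ts) us) (mk⇔
        (λ eq → 𝒫.code-injective (trans (sym (𝒫.step-code ρ ts {p} eqᵖ)) (trans eq eqᑫ)))
        (λ { refl → trans (𝒫.step-code ρ ts {p} eqᵖ) (sym eqᑫ) }))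

-- Configurations

-- The transition table does not depend on the input, so membership in `δ` is settled while the
-- formula is being built; forbidden transitions contribute `falsum`.
guard : ∀ {K n} → Bool → Formula K n → Formula K n
guard b φ = if b then φ else falsum

guard-qf : ∀ {K n} b {φ : Formula K n} → QuantifierFree φ → QuantifierFree (guard b φ)
guard-qf true  q = q
guard-qf false q = falsum

guard-sat : ∀ {K n} (A : Structure K) (ρ : Vec (Carrier A) n) b φ →
            Sat A ρ (guard b φ) ⇔ (b ≡ true × Sat A ρ φ)
guard-sat A ρ true  φ = mk⇔ (refl ,_) proj₂
guard-sat A ρ false φ = mk⇔ (λ ()) (λ ())

module _ {m : ℕ} where

  positionsCode : ℕ → Code (StringSig m)
  positionsCode = powerCode positionCode

  allRead : ∀ {v k} → Vec (TapeSymbol m) k → Vec (Term (StringSig m) v) (width (positionsCode k)) →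
            Formula (StringSig m) v
  allRead []       ts = ⊤′
  allRead (c ∷ cs) ts = reads c (take 2 ts) ∧′ allRead cs (drop 2 ts)

  allRead-qf : ∀ {v k} (cs : Vec (TapeSymbol m) k) (ts : Vec (Term (StringSig m) v) (width (positionsCode k))) →
               QuantifierFree (allRead cs ts)
  allRead-qf []       ts = falsum ⇒′ falsum
  allRead-qf (c ∷ cs) ts = reads-qf c (take 2 ts) ∧′ allRead-qf cs (drop 2 ts)

  allMove : ∀ {v k} → Vec Move k → (ts us : Vec (Term (StringSig m) v) (width (positionsCode k))) →
            Formula (StringSig m) v
  allMove []       ts us = ⊤′
  allMove (μ ∷ μs) ts us = moves μ (take 2 ts) (take 2 us) ∧′ allMove μs (drop 2 ts) (drop 2 us)

  allMove-qf : ∀ {v k} (μs : Vec Move k) (ts us : Vec (Term (StringSig m) v) (width (positionsCode k))) →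
               QuantifierFree (allMove μs ts us)
  allMove-qf []       ts us = falsum ⇒′ falsum
  allMove-qf (μ ∷ μs) ts us =
    moves-qf μ (take 2 ts) (take 2 us) ∧′ allMove-qf μs (drop 2 ts) (drop 2 us)

  module _ {n : ℕ} (x : Vec (Fin m) (suc (suc (suc n)))) where
    private
      N : ℕ
      N = suc (suc (suc n))
      A = ⟦ x ⟧

    positionsCodes : ∀ k → Codes A (⟦⟧-finite x) (positionsCode k) (Vec (Fin (suc (suc N))) k)
    positionsCodes = powerCodes (positionCodes x)

    -- All heads at the left endmarker form the least tuple of positions, so `s` and `t` can be
    -- named by means of `lo`.
    positions-least : ∀ k → Codes.least (positionsCodes k) ≡ replicate k zero
    positions-least zero    = refl
    positions-least (suc k) = cong (zero ∷_) (positions-least k)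

    allRead-sat : ∀ {v} (ρ : Vec (Fin N) v) {k} (cs : Vec (TapeSymbol m) k) ts {ps} →
                  evals A ρ ts ≡ Codes.code (positionsCodes k) ps →
                  Sat A ρ (allRead cs ts) ⇔ (map (lookup (tape x)) ps ≡ cs)
    allRead-sat ρ []       ts {[]}     eq = mk⇔ (λ _ → refl) (λ _ h → h)
    allRead-sat ρ (c ∷ cs) ts {p ∷ ps} eq = ⇔-trans
      (reads-sat x ρ c (take 2 ts) {p} (evals-take A ρ ts eq) ×-⇔
       allRead-sat ρ cs (drop 2 ts) (evals-drop A ρ ts {𝒫.code x p} eq))
      (mk⇔ (λ (h , hs) → cong₂ _∷_ h hs) (λ e → ∷-injectiveˡ e , ∷-injectiveʳ e))

    allMove-sat : ∀ {v} (ρ : Vec (Fin N) v) {k} (μs : Vec Move k) ts us {ps qs} →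
                  evals A ρ ts ≡ Codes.code (positionsCodes k) ps →
                  evals A ρ us ≡ Codes.code (positionsCodes k) qs →
                  Sat A ρ (allMove μs ts us) ⇔ (∀ h → Displaces (lookup μs h) (lookup ps h) (lookup qs h))
    allMove-sat ρ []       ts us {[]}     {[]}     eqᵖ eqᑫ = mk⇔ (λ _ ()) (λ _ h → h)
    allMove-sat ρ (μ ∷ μs) ts us {p ∷ ps} {q ∷ qs} eqᵖ eqᑫ = ⇔-trans
      (moves-sat x ρ μ (take 2 ts) (take 2 us) {p} {q} (evals-take A ρ ts eqᵖ) (evals-take A ρ us eqᑫ) ×-⇔
       allMove-sat ρ μs (drop 2 ts) (drop 2 us)
         (evals-drop A ρ ts {𝒫.code x p} eqᵖ) (evals-drop A ρ us {𝒫.code x q} eqᑫ))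
      (mk⇔ (λ { (h , hs) zero → h ; (h , hs) (suc i) → hs i }) (λ h → h zero , h ∘ suc))

-- The step relation of an automaton as a formula

module _ {m : ℕ} (M : NMFA m) where
  open NMFA M

  configurationCode : Code (StringSig m)
  configurationCode = pairCode (finCode states) (positionsCode heads)

  private w = width configurationCode

  module _ {v : ℕ} (ts us : Vec (Term (StringSig m) v) w) where

    transition : Fin states → Fin states → Vec (TapeSymbol m) heads → Vec Move heads →
                 Formula (StringSig m) v
    transition q q′ a μ = guard (δ q a q′ μ)
      ((take 1 ts ≐* numeral q ∧′ take 1 us ≐* numeral q′) ∧′
       (allRead a (drop 1 ts) ∧′ allMove μ (drop 1 ts) (drop 1 us)))

    private
      module Q = Disjunction (finDisjunction {StringSig m} {v} states)
      module T = Disjunction (vecDisjunction (symbolDisjunction {StringSig m} {v} m) heads)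
      module V = Disjunction (vecDisjunction (moveDisjunction {StringSig m} {v}) heads)

    -- The states and the symbols read are determined by the two configurations; the disjunction
    -- over them turns each into a fixed argument of `δ`. The move vector is the witness that `Step`
    -- asks for.
    stepFormula : Formula (StringSig m) v
    stepFormula = Q.⋁ λ q → Q.⋁ λ q′ → T.⋁ λ a → V.⋁ λ μ → transition q q′ a μ

    stepFormula-qf : QuantifierFree stepFormula
    stepFormula-qf = Q.⋁-qf λ q → Q.⋁-qf λ q′ → T.⋁-qf λ a → V.⋁-qf λ μ →
      guard-qf (δ q a q′ μ)
        ((≐*-qf (take 1 ts) (numeral q) ∧′ ≐*-qf (take 1 us) (numeral q′)) ∧′
         (allRead-qf a (drop 1 ts) ∧′ allMove-qf μ (drop 1 ts) (drop 1 us)))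

    stepFormula-sat : ∀ (A : Structure (StringSig m)) (ρ : Vec (Carrier A) v) →
      Sat A ρ stepFormula ⇔ (∃[ q ] ∃[ q′ ] ∃[ a ] ∃[ μ ] Sat A ρ (transition q q′ a μ))
    stepFormula-sat A ρ = mk⇔
      (λ h → let q  , h₁ = ⇒ (Q.⋁-sat A ρ _) h
                 q′ , h₂ = ⇒ (Q.⋁-sat A ρ _) h₁
                 a  , h₃ = ⇒ (T.⋁-sat A ρ _) h₂
                 μ  , h₄ = ⇒ (V.⋁-sat A ρ (transition q q′ a)) h₃
             in q , q′ , a , μ , h₄)
      (λ (q , q′ , a , μ , h) →
        ⇐ (Q.⋁-sat A ρ _) (q , ⇐ (Q.⋁-sat A ρ _) (q′ , ⇐ (T.⋁-sat A ρ _) (a , ⇐ (V.⋁-sat A ρ (transition q q′ a)) (μ , h)))))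

  terminals : PointSym → Vec (Term (StringSig m) 0) w
  terminals s = numeral q₀ ++ lo (positionsCode heads)
  terminals t = numeral qf ++ lo (positionsCode heads)

  module _ {n : ℕ} (x : Vec (Fin m) (suc (suc (suc n)))) (states≤ : states ≤ suc (suc (suc n))) where
    private
      N : ℕ
      N = suc (suc (suc n))
      A = ⟦ x ⟧
      module 𝒬 = Codes (finCodes x q₀ states≤)
      module 𝒱 = Codes (positionsCodes x heads)

    configurationCodes : Codes A (⟦⟧-finite x) configurationCode (Configuration M N)
    configurationCodes = pairCodes (finCodes x q₀ states≤) (positionsCodes x heads)

    module 𝒞 = Codes configurationCodes

    stepFormula-step : ∀ {v} (ρ : Vec (Fin N) v) ts us {c d} →
                       evals A ρ ts ≡ 𝒞.code c → evals A ρ us ≡ 𝒞.code d →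
                       Sat A ρ (stepFormula ts us) ⇔ Step M x c d
    stepFormula-step ρ ts us {q , ps} {q′ , ps′} eqᶜ eqᵈ = ⇔-trans (stepFormula-sat ts us A ρ) (mk⇔
      (λ (r , r′ , a , μ , h) →
        let δ≡ , (hq , hq′) , (ha , hμ) = ⇒ (guard-sat A ρ (δ r a r′ μ) _) h
        in step-from (⇒ (state ts eqᶜ r) hq) (⇒ (state us eqᵈ r′) hq′)
             (⇒ (allRead-sat x ρ a (drop 1 ts) tsᵖ) ha) δ≡
             (⇒ (allMove-sat x ρ μ (drop 1 ts) (drop 1 us) tsᵖ usᵖ) hμ))
      (λ (μ , δ≡ , disp) →
        -- The disjunct to satisfy is the one for the symbols actually under the heads, which makes
        -- `allRead` hold by reflexivity.
        let a = map (lookup (tape x)) ps in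
        q , q′ , a , μ , ⇐ (guard-sat A ρ (δ q a q′ μ) _)
          (δ≡ , (⇐ (state ts eqᶜ q) refl , ⇐ (state us eqᵈ q′) refl) ,
           (⇐ (allRead-sat x ρ a (drop 1 ts) tsᵖ) refl ,
            ⇐ (allMove-sat x ρ μ (drop 1 ts) (drop 1 us) tsᵖ usᵖ) disp))))
      where
      tsᵖ : evals A ρ (drop 1 ts) ≡ 𝒱.code ps
      tsᵖ = evals-drop A ρ ts {𝒬.code q} eqᶜ

      usᵖ : evals A ρ (drop 1 us) ≡ 𝒱.code ps′
      usᵖ = evals-drop A ρ us {𝒬.code q′} eqᵈ

      state : ∀ vs {q ps} → evals A ρ vs ≡ 𝒞.code (q , ps) → ∀ r →
              Sat A ρ (take 1 vs ≐* numeral r) ⇔ (q ≡ r)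
      state vs eq r = 𝒬.≐*-code ρ (take 1 vs) (numeral r)
        (evals-take A ρ vs eq) (numeral-finCode x ρ q₀ states≤ r)

      step-from : ∀ {r r′ a μ} → q ≡ r → q′ ≡ r′ → map (lookup (tape x)) ps ≡ a → δ r a r′ μ ≡ true →
                  (∀ h → Displaces (lookup μ h) (lookup ps h) (lookup ps′ h)) → Step M x (q , ps) (q′ , ps′)
      step-from refl refl refl δ≡ disp = _ , δ≡ , disp

    terminal-code : ∀ q → evals A [] (numeral q ++ lo (positionsCode heads)) ≡
                          𝒞.code (q , replicate heads zero)
    terminal-code q = trans (evals-++ A [] (numeral q) (lo (positionsCode heads)))
      (cong₂ _++_ (numeral-finCode x [] q₀ states≤ q)
        (trans (𝒱.lo-code []) (cong 𝒱.code (positions-least x heads))))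

    terminals-code : ∀ p → evals A [] (terminals p) ≡ 𝒞.code (fun (configurationGraph M x) p [])
    terminals-code s = terminal-code q₀
    terminals-code t = terminal-code qf

  configurationInterpretation : Interpretation (Γ₂ +S) (StringSig m)
  configurationInterpretation =
    graphInterpretation configurationCode stepFormula stepFormula-qf terminals

  configurationInterpretation-qf : QuantifierFreeInterpretation configurationInterpretation
  configurationInterpretation-qf =
    graphInterpretation-qf configurationCode stepFormula stepFormula-qf terminals

  -- The tags of head positions need three elements and the numerals of states
  -- as many as there are states; the sum is a convenient common bound.
  configurationInterpretation-expansion :
    ∀ {n} (x : Vec (Fin m) (suc n)) → 3 + states ≤ suc n →
    Σ[ closed ∈ Closed ⟦ x ⟧ (⟦⟧-finite x) configurationInterpretation ]
      Σ[ succ ∈ Successor (Configuration M (suc n)) ]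
        interpret ⟦ x ⟧ (⟦⟧-finite x) configurationInterpretation closed ≅
          expand (configurationGraph M x) succ
  configurationInterpretation-expansion {suc (suc n)} x (s≤s (s≤s (s≤s states≤n))) =
    graph-closed configurationCode stepFormula stepFormula-qf terminals
      {G = configurationGraph M x} 𝒢 (stepFormula-step x states≤) (terminals-code x states≤) ,
    Codes.successor 𝒢 ,
    graph-iso configurationCode stepFormula stepFormula-qf terminals
      {G = configurationGraph M x} 𝒢 (stepFormula-step x states≤) (terminals-code x states≤)
    where
    states≤ : states ≤ suc (suc (suc n))
    states≤ = ℕₚ.≤-trans states≤n (ℕₚ.m≤n+m n 3)

    𝒢 : Codes ⟦ x ⟧ (⟦⟧-finite x) configurationCode (Configuration M (suc (suc (suc n))))
    𝒢 = configurationCodes x states≤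
  configurationInterpretation-expansion {zero}     x (s≤s ())
  configurationInterpretation-expansion {suc zero} x (s≤s (s≤s ()))

-- Forgetting the successor structure

≅-reduct : ∀ {L K} (A : Structure K) (fin : IsFinite A) (π : Interpretation (L +S) K) closed
           (B : Structure L) (σ : Successor (Carrier B)) →
           interpret A fin π closed ≅ expand B σ →
           interpret A fin (reduct π) (closed ∘ inj₁) ≅ B
≅-reduct _ _ _ _ _ _ iso = record
  { bijection = bijection ; rel-iso = rel-iso ; fun-iso = λ f → fun-iso (inj₁ f) }
  where open _≅_ iso

theorem2 : ∀ {m : ℕ} (M : NMFA m) →
    Σ[ π ∈ Interpretation Γ₂ (StringSig m) ]
    QuantifierFreeInterpretation π ×
    (∃[ N ] ∀ {n} (x : Vec (Fin m) (suc n)) → N ≤ suc n →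
    Σ[ closed ∈ Closed ⟦ x ⟧ (⟦⟧-finite x) π ]
    interpret ⟦ x ⟧ (⟦⟧-finite x) π closed ≅ configurationGraph M x) ×
    (Σ[ π⁺ ∈ Interpretation (Γ₂ +S) (StringSig m) ]
    reduct π⁺ ≡ π ×
    QuantifierFreeInterpretation π⁺ ×
    (∃[ N ] ∀ {n} (x : Vec (Fin m) (suc n)) → N ≤ suc n →
    Σ[ closed ∈ Closed ⟦ x ⟧ (⟦⟧-finite x) π⁺ ]
    Σ[ succ ∈ Successor (Carrier (configurationGraph M x)) ]
    interpret ⟦ x ⟧ (⟦⟧-finite x) π⁺ closed ≅ expand (configurationGraph M x) succ))
theorem2 M =
  -- The interpretation of the bare graph is taken to be the reduct of the one with successor, so
  -- the latter expands it by `refl`.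
  reduct π⁺ ,
  record { ∂-qf = ∂-qf ; rel-qf = rel-qf ; fun-qf = λ p → fun-qf (inj₁ p) } ,
  (3 + NMFA.states M , λ x N≤ →
    let closed , σ , iso = configurationInterpretation-expansion M x N≤
    in closed ∘ inj₁ , ≅-reduct ⟦ x ⟧ (⟦⟧-finite x) π⁺ closed (configurationGraph M x) σ iso) ,
  π⁺ , refl , configurationInterpretation-qf M ,
  3 + NMFA.states M , configurationInterpretation-expansion M
  where
  π⁺ = configurationInterpretation M
  open QuantifierFreeInterpretation (configurationInterpretation-qf M)
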